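{- Let $F$ be a dynamics from $\mathcal{G}_{\Sigma,\Delta,\pi}$ to $\mathcal{G}_{\Sigma,\Delta,\pi}$. Then $F$ is causal if and only if $F$ is localizable.
   Context: **Graphs.** Fix an uncountable infinite set $V$ of names, sets of states $\Sigma,\Delta$, and a natural number $\pi$ (the degree). A graph $G$ consists of: an at most countable subset $V(G)\subseteq V$ of vertices; the set of ports $1..\pi=\{1,\dots,\pi\}$; a partial function $\sigma_G$ from $V(G)$ to $\Sigma$; and a partial function $\delta_G$ from $(V(G)\times 1..\pi)\times(V(G)\times 1..\pi)$ to $\Delta$ such that each $u\!:\!i:=(u,i)$ appears at most once in $\mathrm{dom}(\delta_G)$. The set of all graphs is $\mathcal{G}_{\Sigma,\Delta,\pi}$; $v\in G$ means $v\in V(G)$. A pointed graph is a pair $(G,A)$ with $A\subseteq V(G)$ (the pointer set); the set of pointed graphs is $\mathcal{P}_{\Sigma,\Delta,\pi}$. **Isomorphisms.** An isomorphism $R$ is a map $\mathcal{G}_{\Sigma,\Delta,\pi}\to\mathcal{G}_{\Sigma,\Delta,\pi}$ specified by a bijection $R(\cdot):V\to V$: $RG$ has vertex set $R(V(G))$, $\sigma_{RG}=\sigma_G\circ R^{ -1}$, $\delta_{RG}=\delta_G\circ R^{ -1}$ (with $R^{ -1}(u\!:\!i)=R^{ -1}(u)\!:\!i$). On pointed graphs, $R(G,A)=(RG,R(A))$. **Dynamics.** A dynamics is a function $F:\mathcal{G}_{\Sigma,\Delta,\pi}\to\mathcal{G}_{\Sigma,\Delta,\pi}$ such that (i) (conjugacy)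 for every isomorphism $R$ there is an isomorphism $R'$ (a conjugate of $R$ through $F$) with $F(RG)=R'F(G)$ for all $G$; (ii) (freshness) for every family of graphs $(G^{(i)})$, if $\bigcap V(G^{(i)})=\emptyset$ then $\bigcap V(F(G^{(i)}))=\emptyset$. The definition extends in the obvious way to functions from (sets of) pointed graphs to $\mathcal{G}_{\Sigma,\Delta,\pi}$. **Disks.** Write $u\frown v$ (in $G$) if there are ports $i,j$ such that $\delta_G(u\!:\!i,v\!:\!j)$ or $\delta_G(v\!:\!j,u\!:\!i)$ is defined; $u\frown^k v$ if there is a chain $u\frown w_1\frown\dots\frown w_{k-1}\frown v$ (with $u\frown^0 v$ iff $u=v$); $u\frown^{\le r}v$ if $u\frown^k v$ for some $k\le r$. The neighbours of radius $r$ of a set $A$ w.r.t. $G$ are the $v\in V(G)$ with $u\frown^{\le r}v$ for some $u\in A$. The induced subgraph $G_U$ of $G$ around a set $U$ has as vertices the neighbours of radius one of $U'=V(G)\cap U$, has $\sigma_{G_U}$ the restriction of $\sigma_G$ to $U'$, and $\delta_{G_U}$ the restriction of $\delta_G$ to $\big((V(G_U)\times 1..\pi)\times(U'\times 1..\pi)\big)\cup\big((U'\times 1..\pi)\times(V(G_U)\times 1..\pi)\big)$. Write $G_v$ for $G_{\{v\}}$. The envelope $G^r_A$ of radius $r$ of a set $A$ is the pointed graph whose graph is the induced subgraph of $G$ around the neighbours of radius $r$ of $A$ and whose pointer set is $A$. Write $G^r_v$ for $G^r_{\{v\}}$; the set of disks of radius $r$ is $\mathcal{D}^r_{\Sigma,\Delta,\pi}=\{G^r_v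 : G\in\mathcal{G}_{\Sigma,\Delta,\pi},\ v\in G\}$. **Antecedents and causality.** The antecedent codynamics of a dynamics $F$ is the map $a$ from $V$ to subsets of $V$ with $v\in a(v')$ iff for all $G$, $[v'\in F(G)\Rightarrow v\in G]$. $F$ is causal if there exist a radius $r$ and a bound $b$ such that (i) for all $v'$, all $v\in a(v')$ and all graphs $G,H$: $G^r_v=H^r_v\Rightarrow F(G)_{v'}=F(H)_{v'}$; (ii) for all $G$ and all $v\in G$: $|\{v'\in F(G) : v\in a(v')\}|\le b$. **Consistency and union.** Graphs $G,H$ are consistent if, with $U'=V(G)\cap V(H)$: for all $u\in U'$, $\sigma_G(u)$ and $\sigma_H(u)$ agree when both are defined; and for all $u\!:\!i$ with $u\in U'$ and all $v\!:\!j$, $v'\!:\!j'$ with $v,v'\in V(G)\cup V(H)$, $[\delta_G(u\!:\!i,v\!:\!j)=d\wedge\delta_H(u\!:\!i,v'\!:\!j')=d']\Rightarrow(v=v'\wedge j=j'\wedge d=d')$ and $[\delta_G(v\!:\!j,u\!:\!i)=d\wedge\delta_H(v'\!:\!j',u\!:\!i)=d']\Rightarrow(v=v'\wedge j=j'\wedge d=d')$. The union of consistent graphs has the union of the vertex sets as vertices, and its partial functions $\sigma,\delta$ have as domains the unions of the respective domains and coincide with the given ones there; likewise for unions of families of pairwise consistent graphs. **Localizable.** A function $f:\mathcal{D}^r_{\Sigma,\Delta,\pi}\to\mathcal{G}_{\Sigma,\Delta,\pi}$ is consistent if for every graph $G$ and all $u,v\in G$, $f(G^r_u)$ and $f(G^r_v)$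 are consistent; it is bounded if there is $b$ with $|V(f(D))|\le b$ for all $D$. It is a local rule of radius $r$ if it is a consistent, bounded dynamics. A dynamics $F$ is localizable if there exist a radius $r$ and a local rule $f$ of radius $r$ such that for every graph $G\in\mathcal{G}_{\Sigma,\Delta,\pi}$, $F(G)=\bigcup_{v\in G}f(G^r_v)$. -}

module Defs where

open import Level using (Level; _⊔_) renaming (suc to lsuc)
open import Data.Empty using (⊥)
open import Data.Fin.Base using (Fin)
open import Data.Nat.Base using (ℕ; zero; suc; _≤_; z≤n)
open import Data.Product using (Σ; Σ-syntax; ∃; ∃-syntax; _×_; _,_; proj₁; proj₂; map₁; map₂)
open import Data.Sum.Base as Sum using (_⊎_; inj₁; inj₂)
open import Function.Base using (_∘_)
open import Function.Bundles
  using (Inverse; _↔_; Injection; _⟶ₛ_; _⟨$⟩_)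
open import Relation.Binary.Bundles using (Setoid)
import Relation.Binary.Construct.On as On
open import Relation.Binary.PropositionalEquality
  using (_≡_; refl; sym; trans; cong; subst; setoid)
open import Relation.Nullary using (¬_)
open import Relation.Unary using (Pred; _∈_; _⊆_; _≐_; _∩_; _∪_; U; ｛_｝; Empty; ⋂)
open import Relation.Unary.Properties using (≐-refl; ≐-sym; ≐-trans)

private variable
  a p : Level

-- Elements of a subset are compared by their underlying point, so that maps
-- out of a subset do not depend on the proof of membership.
subset : {A : Set a} → Pred A p → Setoid (a ⊔ p) a
subset {A = A} P = On.setoid {B = Σ A P} (setoid A) proj₁

AtMostCountable : {A : Set a} → Pred A p → Set (a ⊔ p)
AtMostCountable P = Injection (subset P) (setoid ℕ)

∣_∣≤_ : {A : Set a} → Pred A p → ℕ → Set (a ⊔ p)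
∣ P ∣≤ b = Injection (subset P) (setoid (Fin b))

Uncountable : Set a → Set a
Uncountable A = ¬ AtMostCountable {A = A} U

-- Names V, states S of vertices, states Δ of edges, degree π.
module GraphDynamics {ℓ : Level} (V S Δ : Set ℓ) (π : ℕ) where

  Port : Set ℓ
  Port = V × Fin π

  -- Partial functions are given by their graphs: σ v s means that σ is
  -- defined at v with value s.  A port occurs at most once in dom δ: the
  -- three cases are two occurrences as a source, two as a target, and one of
  -- each.  The last covers the single edge (x , x), which is thus excluded.
  record Graph : Set (lsuc ℓ) where
    field
      verts     : Pred V ℓ
      countable : AtMostCountable verts
      σ         : V → Pred S ℓ
      σ-dom     : ∀ {v s} → σ v s → v ∈ verts
      σ-func    : ∀ {v s t} → σ v s → σ v t → s ≡ t
      δ         : Port → Port → Pred Δ ℓ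
      δ-dom     : ∀ {x y d} → δ x y d → proj₁ x ∈ verts × proj₁ y ∈ verts
      δ-func    : ∀ {x y d e} → δ x y d → δ x y e → d ≡ e
      δ-source  : ∀ {x y y′ d d′} → δ x y d → δ x y′ d′ → y ≡ y′
      δ-target  : ∀ {x x′ y d d′} → δ x y d → δ x′ y d′ → x ≡ x′
      δ-mixed   : ∀ {x y y′ d d′} → δ x y d → δ y′ x d′ → ⊥

  open Graph public

  -- Equality of graphs is extensional equality of the components.
  infix 4 _≈_
  record _≈_ (G H : Graph) : Set ℓ where
    field
      verts-≐ : verts G ≐ verts H
      σ-≐     : ∀ v → σ G v ≐ σ H v
      δ-≐     : ∀ x y → δ G x y ≐ δ H x y

  open _≈_ public

  ≈-refl : ∀ {G} → G ≈ G
  ≈-refl = record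
    { verts-≐ = ≐-refl ; σ-≐ = λ _ → ≐-refl ; δ-≐ = λ _ _ → ≐-refl }

  ≈-sym : ∀ {G H} → G ≈ H → H ≈ G
  ≈-sym e = record
    { verts-≐ = ≐-sym (verts-≐ e)
    ; σ-≐     = λ v → ≐-sym (σ-≐ e v)
    ; δ-≐     = λ x y → ≐-sym (δ-≐ e x y)
    }

  ≈-trans : ∀ {G H K} → G ≈ H → H ≈ K → G ≈ K
  ≈-trans e f = record
    { verts-≐ = ≐-trans (verts-≐ e) (verts-≐ f)
    ; σ-≐     = λ v → ≐-trans (σ-≐ e v) (σ-≐ f v)
    ; δ-≐     = λ x y → ≐-trans (δ-≐ e x y) (δ-≐ f x y)
    }

  𝒢 : Setoid (lsuc ℓ) ℓ
  𝒢 = record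
    { Carrier       = Graph
    ; _≈_           = _≈_
    ; isEquivalence = record { refl = ≈-refl ; sym = ≈-sym ; trans = ≈-trans }
    }

  record PointedGraph : Set (lsuc ℓ) where
    field
      graph     : Graph
      pointer   : Pred V ℓ
      pointer-⊆ : pointer ⊆ verts graph

  open PointedGraph public

  infix 4 _≈ᴾ_
  record _≈ᴾ_ (X Y : PointedGraph) : Set ℓ where
    field
      graph-≈   : graph X ≈ graph Y
      pointer-≐ : pointer X ≐ pointer Y

  open _≈ᴾ_ public

  ≈ᴾ-refl : ∀ {X} → X ≈ᴾ X
  ≈ᴾ-refl = record { graph-≈ = ≈-refl ; pointer-≐ = ≐-refl }

  ≈ᴾ-sym : ∀ {X Y} → X ≈ᴾ Y → Y ≈ᴾ X
  ≈ᴾ-sym e = record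
    { graph-≈ = ≈-sym (graph-≈ e) ; pointer-≐ = ≐-sym (pointer-≐ e) }

  ≈ᴾ-trans : ∀ {X Y Z} → X ≈ᴾ Y → Y ≈ᴾ Z → X ≈ᴾ Z
  ≈ᴾ-trans e f = record
    { graph-≈   = ≈-trans (graph-≈ e) (graph-≈ f)
    ; pointer-≐ = ≐-trans (pointer-≐ e) (pointer-≐ f)
    }

  𝒫 : Setoid (lsuc ℓ) ℓ
  𝒫 = record
    { Carrier       = PointedGraph
    ; _≈_           = _≈ᴾ_
    ; isEquivalence = record { refl = ≈ᴾ-refl ; sym = ≈ᴾ-sym ; trans = ≈ᴾ-trans }
    }

  Iso : Set ℓ
  Iso = V ↔ V

  module _ (R : Iso) where
    open Inverse R using (to; from; strictlyInverseˡ; strictlyInverseʳ)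

    from-injective : ∀ {u v} → from u ≡ from v → u ≡ v
    from-injective {u} {v} eq =
      trans (sym (strictlyInverseˡ u)) (trans (cong to eq) (strictlyInverseˡ v))

    from-port-injective : ∀ {x y : Port} → map₁ from x ≡ map₁ from y → x ≡ y
    from-port-injective {u , i} {v , j} eq
      with from-injective (cong proj₁ eq) | cong proj₂ eq
    ... | refl | refl = refl

    -- The image of a subset under R is its preimage under R⁻¹.
    image : Pred V ℓ → Pred V ℓ
    image A = A ∘ from

    infixr 6 _·_ _·ᴾ_

    _·_ : Graph → Graph
    _·_ G = record
      { verts     = image (verts G)
      ; countable = record
        { to        = λ (v , m) → C.to (from v , m)
        ; cong      = λ eq → C.cong (cong from eq)
        ; injective = λ eq → from-injective (C.injective eq)
        }
      ; σ         = λ v → σ G (from v)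
      ; σ-dom     = σ-dom G
      ; σ-func    = σ-func G
      ; δ         = λ x y → δ G (map₁ from x) (map₁ from y)
      ; δ-dom     = δ-dom G
      ; δ-func    = δ-func G
      ; δ-source  = λ d e → from-port-injective (δ-source G d e)
      ; δ-target  = λ d e → from-port-injective (δ-target G d e)
      ; δ-mixed   = δ-mixed G
      } where module C = Injection (countable G)

    _·ᴾ_ : PointedGraph → PointedGraph
    _·ᴾ_ X = record
      { graph     = _·_ (graph X)
      ; pointer   = image (pointer X)
      ; pointer-⊆ = pointer-⊆ X
      }

    image-cong : ∀ {A B} → A ≐ B → image A ≐ image B
    image-cong (f , g) = (λ {_} → f) , (λ {_} → g)

    ·ᴾ-cong : ∀ {X Y} → X ≈ᴾ Y → _·ᴾ_ X ≈ᴾ _·ᴾ_ Y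
    ·ᴾ-cong e = record
      { graph-≈ = record
        { verts-≐ = image-cong (verts-≐ (graph-≈ e))
        ; σ-≐     = λ v → σ-≐ (graph-≈ e) (from v)
        ; δ-≐     = λ x y → δ-≐ (graph-≈ e) (map₁ from x) (map₁ from y)
        }
      ; pointer-≐ = image-cong (pointer-≐ e)
      }

  Adj : Graph → V → V → Set ℓ
  Adj G u v = ∃[ i ] ∃[ j ] (∃ (δ G (u , i) (v , j)) ⊎ ∃ (δ G (v , j) (u , i)))

  Chain : Graph → ℕ → V → V → Set ℓ
  Chain G zero    u v = u ≡ v
  Chain G (suc k) u v = ∃[ w ] (Adj G u w × Chain G k w v)

  Within : Graph → ℕ → V → V → Set ℓ
  Within G r u v = ∃[ k ] (k ≤ r × Chain G k u v)

  neighbours : Graph → ℕ → Pred V ℓ → Pred V ℓ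
  neighbours G r A v = v ∈ verts G × ∃[ u ] (u ∈ A × Within G r u v)

  induced : Graph → Pred V ℓ → Graph
  induced G A = record
    { verts     = W
    ; countable = record
      { to        = λ (v , m) → C.to (v , proj₁ m)
      ; cong      = C.cong
      ; injective = C.injective
      }
    ; σ         = λ v s → σ G v s × v ∈ A′
    ; σ-dom     = λ (_ , m) → A′⊆W m
    ; σ-func    = λ (s , _) (t , _) → σ-func G s t
    ; δ         = λ x y d → δ G x y d ×
                    ((proj₁ x ∈ W × proj₁ y ∈ A′) ⊎ (proj₁ x ∈ A′ × proj₁ y ∈ W))
    ; δ-dom     = λ { (_ , inj₁ (m , n)) → m , A′⊆W n
                    ; (_ , inj₂ (m , n)) → A′⊆W m , n }
    ; δ-func    = λ (d , _) (e , _) → δ-func G d e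
    ; δ-source  = λ (d , _) (e , _) → δ-source G d e
    ; δ-target  = λ (d , _) (e , _) → δ-target G d e
    ; δ-mixed   = λ (d , _) (e , _) → δ-mixed G d e
    }
    where
    module C = Injection (countable G)
    A′ W : Pred V ℓ
    A′ = verts G ∩ A
    W  = neighbours G 1 A′
    A′⊆W : A′ ⊆ W
    A′⊆W {v} m = proj₁ m , v , m , 0 , z≤n , refl

  envelope : (G : Graph) (r : ℕ) (A : Pred V ℓ) → A ⊆ verts G → PointedGraph
  envelope G r A A⊆G = record
    { graph     = induced G (neighbours G r A)
    ; pointer   = A
    ; pointer-⊆ = λ {v} m →
        let m′ = A⊆G m , A⊆G m , v , m , 0 , z≤n , refl
        in A⊆G m , v , m′ , 0 , z≤n , refl
    }

  disk : (G : Graph) (r : ℕ) (v : V) → v ∈ verts G → PointedGraph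
  disk G r v v∈G = envelope G r ｛ v ｝ λ { refl → v∈G }

  IsDisk : ℕ → Pred PointedGraph (lsuc ℓ)
  IsDisk r X = Σ[ G ∈ Graph ] Σ[ v ∈ V ] Σ[ v∈G ∈ v ∈ verts G ] X ≈ᴾ disk G r v v∈G

  𝒟 : ℕ → Setoid (lsuc ℓ) ℓ
  𝒟 r = On.setoid {B = Σ PointedGraph (IsDisk r)} 𝒫 proj₁

  diskOf : (r : ℕ) (G : Graph) (v : V) → v ∈ verts G → Setoid.Carrier (𝒟 r)
  diskOf r G v v∈G = disk G r v v∈G , G , v , v∈G , ≈ᴾ-refl

  -- Disks are stable under isomorphisms: (R · G)^r_{R(v)} = R · G^r_v.
  module _ (R : Iso) where
    open Inverse R using (to; from; strictlyInverseˡ; strictlyInverseʳ)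

    Chain⇒ : ∀ {G} k {u v} → Chain (R · G) k u v → Chain G k (from u) (from v)
    Chain⇒ zero    eq          = cong from eq
    Chain⇒ (suc k) (w , a , c) = from w , a , Chain⇒ k c

    Chain⇐ : ∀ {G} k {u v} → Chain G k (from u) (from v) → Chain (R · G) k u v
    Chain⇐ zero eq = from-injective R eq
    Chain⇐ {G} (suc k) {u} {v} (w , a , c) =
        to w
      , subst (Adj G (from u)) (sym (strictlyInverseʳ w)) a
      , Chain⇐ k (subst (λ z → Chain G k z (from v)) (sym (strictlyInverseʳ w)) c)

    neighbours-image : ∀ G r A →
      neighbours (R · G) r (image R A) ≐ image R (neighbours G r A)
    neighbours-image G r A =
        (λ (m , u , n , k , k≤r , c) → m , from u , n , k , k≤r , Chain⇒ k c)
      , (λ {v} (m , u , n , k , k≤r , c) →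
           m , to u , subst A (sym (strictlyInverseʳ u)) n , k , k≤r
         , Chain⇐ k (subst (λ z → Chain G k z (from v)) (sym (strictlyInverseʳ u)) c))

    neighbours-cong : ∀ G r {A B} → A ≐ B → neighbours G r A ≐ neighbours G r B
    neighbours-cong G r (f , g) =
        (λ (m , u , n , w) → m , u , f n , w)
      , (λ (m , u , n , w) → m , u , g n , w)

    induced-cong : ∀ G {A B} → A ≐ B → induced G A ≈ induced G B
    induced-cong G {A} {B} (f , g) = record
      { verts-≐ = W
      ; σ-≐     = λ _ → map₂ (map₂ f) , map₂ (map₂ g)
      ; δ-≐     = λ _ _ →
          map₂ (Sum.map (λ (m , n) → proj₁ W m , map₂ f n) (λ (m , n) → map₂ f m , proj₁ W n))
        , map₂ (Sum.map (λ (m , n) → proj₂ W m , map₂ g n) (λ (m , n) → map₂ g m , proj₂ W n))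
      }
      where
      W : neighbours G 1 (verts G ∩ A) ≐ neighbours G 1 (verts G ∩ B)
      W = neighbours-cong G 1 ((λ {_} → map₂ f) , (λ {_} → map₂ g))

    induced-image : ∀ G A → induced (R · G) (image R A) ≈ R · induced G A
    induced-image G A = record
      { verts-≐ = W
      ; σ-≐     = λ _ → ≐-refl
      ; δ-≐     = λ _ _ →
          map₂ (Sum.map (map₁ (proj₁ W)) (map₂ (proj₁ W)))
        , map₂ (Sum.map (map₁ (proj₂ W)) (map₂ (proj₂ W)))
      }
      where
      W : neighbours (R · G) 1 (image R (verts G ∩ A)) ≐ image R (neighbours G 1 (verts G ∩ A))
      W = neighbours-image G 1 (verts G ∩ A)

    to-∈ : ∀ G {v} → v ∈ verts G → to v ∈ verts (R · G)
    to-∈ G {v} = subst (verts G) (sym (strictlyInverseʳ v))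

    image-singleton : ∀ v → image R ｛ v ｝ ≐ ｛ to v ｝
    image-singleton v =
        (λ {u} eq → trans (cong to eq) (strictlyInverseˡ u))
      , (λ eq → trans (sym (strictlyInverseʳ v)) (cong from eq))

    disk-image : ∀ G r v (v∈G : v ∈ verts G) →
      R ·ᴾ disk G r v v∈G ≈ᴾ disk (R · G) r (to v) (to-∈ G v∈G)
    disk-image G r v v∈G = record
      { graph-≈ = ≈-trans (≈-sym (induced-image G (neighbours G r ｛ v ｝)))
          (induced-cong (R · G)
            (≐-trans (≐-sym (neighbours-image G r ｛ v ｝))
                     (neighbours-cong (R · G) r (image-singleton v))))
      ; pointer-≐ = image-singleton v
      }

    _·ᴰ_ : ∀ {r} → Setoid.Carrier (𝒟 r) → Setoid.Carrier (𝒟 r)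
    _·ᴰ_ {r} (X , G , v , v∈G , e) =
        R ·ᴾ X , R · G , to v , to-∈ G v∈G
      , ≈ᴾ-trans (·ᴾ-cong R e) (disk-image G r v v∈G)

  -- The possible domains of a dynamics: a set of graphs or pointed graphs,
  -- with its vertex sets and its action of isomorphisms.
  record Domain : Set (lsuc (lsuc ℓ)) where
    field
      elements : Setoid (lsuc ℓ) ℓ
    open Setoid elements public using (Carrier)
    field
      vertices : Carrier → Pred V ℓ
      act      : Iso → Carrier → Carrier

  graphs : Domain
  graphs = record { elements = 𝒢 ; vertices = verts ; act = _·_ }

  disks : ℕ → Domain
  disks r = record
    { elements = 𝒟 r
    ; vertices = λ (X , _) → verts (graph X)
    ; act      = λ R D → R ·ᴰ D
    }

  -- A family indexed by a type at the level of Graph can enumerate any set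
  -- of graphs.
  record IsDynamics (X : Domain) (F : Domain.elements X ⟶ₛ 𝒢) : Set (lsuc (lsuc ℓ)) where
    open Domain X
    field
      conjugacy : ∀ R → ∃[ R′ ] (∀ G → F ⟨$⟩ act R G ≈ R′ · (F ⟨$⟩ G))
      freshness : ∀ (I : Set (lsuc ℓ)) (G : I → Carrier) →
        Empty (⋂ I λ i → vertices (G i)) →
        Empty (⋂ I λ i → verts (F ⟨$⟩ G i))

  antecedents : 𝒢 ⟶ₛ 𝒢 → V → Pred V (lsuc ℓ)
  antecedents F v′ v = ∀ G → v′ ∈ verts (F ⟨$⟩ G) → v ∈ verts G

  Causal : 𝒢 ⟶ₛ 𝒢 → Set (lsuc ℓ)
  Causal F = Σ[ r ∈ ℕ ] Σ[ b ∈ ℕ ]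
      (∀ v′ v → v ∈ antecedents F v′ →
         ∀ G H (v∈G : v ∈ verts G) (v∈H : v ∈ verts H) →
         disk G r v v∈G ≈ᴾ disk H r v v∈H →
         induced (F ⟨$⟩ G) ｛ v′ ｝ ≈ induced (F ⟨$⟩ H) ｛ v′ ｝)
    × (∀ G v → v ∈ verts G →
         ∣ (λ v′ → v′ ∈ verts (F ⟨$⟩ G) × v ∈ antecedents F v′) ∣≤ b)

  -- A port may be a source in G and a target in H, so the union of consistent
  -- graphs need not be a graph; hence IsUnion below is a relation rather than
  -- an operation.
  record Consistent (G H : Graph) : Set ℓ where
    field
      σ-agree : ∀ {u s t} → u ∈ verts G ∩ verts H → σ G u s → σ H u t → s ≡ t
      δ-agree-source : ∀ {u i y y′ d d′} → u ∈ verts G ∩ verts H →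
        δ G (u , i) y d → δ H (u , i) y′ d′ → y ≡ y′ × d ≡ d′
      δ-agree-target : ∀ {u i x x′ d d′} → u ∈ verts G ∩ verts H →
        δ G x (u , i) d → δ H x′ (u , i) d′ → x ≡ x′ × d ≡ d′

  record IsUnion {i} {I : Set i} (G : I → Graph) (K : Graph) : Set (ℓ ⊔ i) where
    field
      verts-⋃ : verts K ≐ (λ v → ∃[ i ] verts (G i) v)
      σ-⋃     : ∀ v → σ K v ≐ (λ s → ∃[ i ] σ (G i) v s)
      δ-⋃     : ∀ x y → δ K x y ≐ (λ d → ∃[ i ] δ (G i) x y d)

  record IsLocalRule (r : ℕ) (f : 𝒟 r ⟶ₛ 𝒢) : Set (lsuc (lsuc ℓ)) where
    field
      consistent : ∀ G u v (u∈G : u ∈ verts G) (v∈G : v ∈ verts G) →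
        Consistent (f ⟨$⟩ diskOf r G u u∈G) (f ⟨$⟩ diskOf r G v v∈G)
      bounded    : Σ[ b ∈ ℕ ] (∀ D → ∣ verts (f ⟨$⟩ D) ∣≤ b)
      isDynamics : IsDynamics (disks r) f

  Localizable : 𝒢 ⟶ₛ 𝒢 → Set (lsuc (lsuc ℓ))
  Localizable F = Σ[ r ∈ ℕ ] Σ[ f ∈ 𝒟 r ⟶ₛ 𝒢 ] IsLocalRule r f ×
    (∀ G → IsUnion (λ ((v , v∈G) : ∃ (verts G)) → f ⟨$⟩ diskOf r G v v∈G) (F ⟨$⟩ G))

{-# OPTIONS --safe #-}

-- Causal ⇒ localizable: the rule sends a disk D centred at v to the part of
-- F(D) around the vertices having v as an antecedent.  A disk is its own disk,
-- so causality makes this the same part of F(G) for every G with that disk at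
-- v, and these parts cover F(G) because freshness gives every name an
-- antecedent.
--
-- Localizable ⇒ causal: if v is an antecedent of v′ and v′ lies in f(G^r_u),
-- then v lies in G^r_u.  So everything that F(G) has around v′ comes from disks
-- centred within r + 1 of v; they are determined by the disk of radius 2r + 1
-- at v, and there are at most (1 + π)^(r + 1) of them.

module Submission where

open import Defs
open import Level using (Level; _⊔_; Lift; lift; lower) renaming (suc to lsuc)
open import Axiom.ExcludedMiddle using (ExcludedMiddle)
open import Data.Empty using (⊥-elim)
open import Data.Fin.Base using (Fin; zero; suc; combine)
open import Data.Fin.Properties using (combine-injective)
open import Data.Nat.Base using (ℕ; zero; suc; _+_; _*_; _^_; _≤_; z≤n; s≤s)
open import Data.Nat.Properties
  using (≤-refl; ≤-reflexive; ≤-trans; m≤n+m; +-mono-≤; +-suc; +-comm)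
open import Data.Product using (Σ-syntax; ∃; ∃-syntax; _×_; _,_; proj₁; proj₂; map₁; map₂)
open import Data.Sum.Base as Sum using (_⊎_; inj₁; inj₂)
open import Data.Unit.Base using (tt)
open import Function.Base using (_∘_)
open import Function.Bundles
  using (_⇔_; _⟶ₛ_; _⟨$⟩_; Func; Inverse; Injection; mk⇔)
open import Function.Construct.Symmetry using (↔-sym)
open import Relation.Binary.PropositionalEquality
  using (_≡_; refl; sym; trans; cong; subst)
open import Relation.Nullary using (Dec; yes; no)
open import Relation.Nullary.Decidable
  using (True; toWitness; fromWitness; map′; decidable-stable)
open import Relation.Unary using (Pred; _∈_; _⊆_; _∩_; U; ｛_｝)

private variable
  a p q : Level

-- Cardinality bounds for subsets.

module Bounds {ℓ : Level} (em : ExcludedMiddle ℓ) where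

  ∣∣≤-mono : {A : Set a} {P : Pred A p} {Q : Pred A q} {n : ℕ} →
    P ⊆ Q → ∣ Q ∣≤ n → ∣ P ∣≤ n
  ∣∣≤-mono P⊆Q inj = record
    { to        = λ (v , m) → I.to (v , P⊆Q m)
    ; cong      = I.cong
    ; injective = I.injective
    } where module I = Injection inj

  -- The code of v is extracted from em at a proposition that mentions only v,
  -- so it does not depend on the proof of v ∈ P.
  ∣∣≤-coded : {A : Set a} {P : Pred A p} {n : ℕ} (C : Fin n → Pred A ℓ) →
    (∀ {c v w} → v ∈ C c → w ∈ C c → v ≡ w) →
    (∀ {v} → v ∈ P → ∃[ c ] v ∈ C c) → ∣ P ∣≤ n
  ∣∣≤-coded {A = A} {P} {n} C unique cover = record
    { to        = λ (v , m) → code em m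
    ; cong      = λ { {v , m} {_ , m′} refl → code-irr em m m′ }
    ; injective = λ { {v , m} {w , m′} eq →
        unique (code-∈ em m) (subst (λ c → w ∈ C c) (sym eq) (code-∈ em m′)) }
    }
    where
    code : ∀ {v} → Dec (∃[ c ] v ∈ C c) → v ∈ P → Fin n
    code (yes (c , _)) _ = c
    code (no ¬c)       m = ⊥-elim (¬c (cover m))
    code-irr : ∀ {v} (d : Dec (∃[ c ] v ∈ C c)) (m m′ : v ∈ P) → code d m ≡ code d m′
    code-irr (yes _) _ _ = refl
    code-irr (no ¬c) m _ = ⊥-elim (¬c (cover m))
    code-∈ : ∀ {v} (d : Dec (∃[ c ] v ∈ C c)) (m : v ∈ P) → v ∈ C (code d m)
    code-∈ (yes (_ , h)) _ = h
    code-∈ (no ¬c)       m = ⊥-elim (¬c (cover m))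

  -- A point is coded by the pair of the code of some `u` and its own code in `Q u`. The first
  -- component recovers `u`, after which the second recovers the point.
  ∣∣≤-⋃ : {A : Set ℓ} {P : Pred A ℓ} {Q : A → Pred A ℓ} {n m : ℕ} →
    ∣ P ∣≤ n → (∀ u → ∣ Q u ∣≤ m) → ∣ (λ v → ∃[ u ] (u ∈ P × v ∈ Q u)) ∣≤ (n * m)
  ∣∣≤-⋃ {P = P} {Q} inj injs = ∣∣≤-coded
    (λ c v → ∃[ u ] Σ[ x ∈ P u ] Σ[ y ∈ Q u v ]
       combine (I.to (u , x)) (J.to u (v , y)) ≡ c)
    unique
    (λ (u , x , y) → _ , u , x , y , refl)
    where
    module I = Injection inj
    module J u = Injection (injs u)
    unique : ∀ {c v w} →
      (∃[ u ] Σ[ x ∈ P u ] Σ[ y ∈ Q u v ] combine (I.to (u , x)) (J.to u (v , y)) ≡ c) →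
      (∃[ u ] Σ[ x ∈ P u ] Σ[ y ∈ Q u w ] combine (I.to (u , x)) (J.to u (w , y)) ≡ c) →
      v ≡ w
    unique (u , x , y , e) (u′ , x′ , y′ , e′)
      with combine-injective _ _ _ _ (trans e (sym e′))
    ... | e₁ , e₂ with I.injective e₁
    ...   | refl = J.injective u e₂

-- Inclusion of graphs, relative to a set of vertices.

module Locality {ℓ : Level} (V S Δ : Set ℓ) (π : ℕ) where
  open GraphDynamics V S Δ π

  -- Every vertex of A in G, with its state and all its edges, belongs to H.
  infix 4 _⊑[_]_ _⊑_
  record _⊑[_]_ (G : Graph) (A : Pred V a) (H : Graph) : Set (ℓ ⊔ a) where
    field
      verts-⊑ : ∀ {v} → v ∈ A → v ∈ verts G → v ∈ verts H
      σ-⊑     : ∀ {v s} → v ∈ A → σ G v s → σ H v s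
      δ-⊑     : ∀ {x y d} → proj₁ x ∈ A ⊎ proj₁ y ∈ A → δ G x y d → δ H x y d

  open _⊑[_]_

  _⊑_ : Graph → Graph → Set ℓ
  G ⊑ H = G ⊑[ U ] H

  ⊑-trans : ∀ {G H K} {A : Pred V a} → G ⊑[ A ] H → H ⊑[ A ] K → G ⊑[ A ] K
  ⊑-trans h k = record
    { verts-⊑ = λ m → verts-⊑ k m ∘ verts-⊑ h m
    ; σ-⊑     = λ m → σ-⊑ k m ∘ σ-⊑ h m
    ; δ-⊑     = λ m → δ-⊑ k m ∘ δ-⊑ h m
    }

  ⊑-weaken : ∀ {G H} {A : Pred V a} → G ⊑ H → G ⊑[ A ] H
  ⊑-weaken h = record
    { verts-⊑ = λ _ → verts-⊑ h tt
    ; σ-⊑     = λ _ → σ-⊑ h tt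
    ; δ-⊑     = λ _ → δ-⊑ h (inj₁ tt)
    }

  ⊑-pointwise : ∀ {G H} {A : Pred V a} → (∀ {v} → v ∈ A → G ⊑[ ｛ v ｝ ] H) → G ⊑[ A ] H
  ⊑-pointwise h = record
    { verts-⊑ = λ m → verts-⊑ (h m) refl
    ; σ-⊑     = λ m → σ-⊑ (h m) refl
    ; δ-⊑     = λ { (inj₁ m) → δ-⊑ (h m) (inj₁ refl)
                  ; (inj₂ m) → δ-⊑ (h m) (inj₂ refl) }
    }

  ≈⇒⊑ : ∀ {G H} → G ≈ H → G ⊑ H
  ≈⇒⊑ e = record
    { verts-⊑ = λ _ → proj₁ (verts-≐ e)
    ; σ-⊑     = λ _ → proj₁ (σ-≐ e _)
    ; δ-⊑     = λ _ → proj₁ (δ-≐ e _ _)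
    }

  ⊑-antisym : ∀ {G H} → G ⊑ H → H ⊑ G → G ≈ H
  ⊑-antisym h k = record
    { verts-≐ = verts-⊑ h tt , verts-⊑ k tt
    ; σ-≐     = λ _ → σ-⊑ h tt , σ-⊑ k tt
    ; δ-≐     = λ _ _ → δ-⊑ h (inj₁ tt) , δ-⊑ k (inj₁ tt)
    }

  -- Any disagreement would already occur inside `K`, where a port carries at most one edge.
  ⊑⇒Consistent : ∀ {G H K} → G ⊑ K → H ⊑ K → Consistent G H
  ⊑⇒Consistent {K = K} h k = record
    { σ-agree        = λ _ s t → σ-func K (σ-⊑ h tt s) (σ-⊑ k tt t)
    ; δ-agree-source = λ _ d e → source (δ-⊑ h (inj₁ tt) d) (δ-⊑ k (inj₁ tt) e)
    ; δ-agree-target = λ _ d e → target (δ-⊑ h (inj₁ tt) d) (δ-⊑ k (inj₁ tt) e)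
    }
    where
    source : ∀ {x y y′ d d′} → δ K x y d → δ K x y′ d′ → y ≡ y′ × d ≡ d′
    source d e with δ-source K d e
    ... | refl = refl , δ-func K d e
    target : ∀ {x x′ y d d′} → δ K x y d → δ K x′ y d′ → x ≡ x′ × d ≡ d′
    target d e with δ-target K d e
    ... | refl = refl , δ-func K d e

  -- Adjacency, chains and distance.

  Adj-verts : ∀ G {u v} → Adj G u v → u ∈ verts G × v ∈ verts G
  Adj-verts G (_ , _ , inj₁ (_ , d)) = δ-dom G d
  Adj-verts G (_ , _ , inj₂ (_ , d)) = proj₂ (δ-dom G d) , proj₁ (δ-dom G d)

  Adj-sym : ∀ G {u v} → Adj G u v → Adj G v u
  Adj-sym G (i , j , e) = j , i , Sum.swap e

  Adj-mono : ∀ {G H} {A : Pred V a} {u v} → G ⊑[ A ] H → u ∈ A → Adj G u v → Adj H u v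
  Adj-mono h m (i , j , e) =
    i , j , Sum.map (map₂ (δ-⊑ h (inj₁ m))) (map₂ (δ-⊑ h (inj₂ m))) e

  Chain-++ : ∀ {G} k l {u v w} → Chain G k u v → Chain G l v w → Chain G (k + l) u w
  Chain-++ zero    l refl         c′ = c′
  Chain-++ (suc k) l (x , e , c) c′ = x , e , Chain-++ k l c c′

  Chain-sym : ∀ {G} k {u v} → Chain G k u v → Chain G k v u
  Chain-sym zero            eq          = sym eq
  Chain-sym {G} (suc k) {u} {v} (w , e , c) =
    subst (λ l → Chain G l v u) (+-comm k 1)
      (Chain-++ k 1 (Chain-sym k c) (u , Adj-sym G e , refl))

  Chain-mono : ∀ {G H} → G ⊑ H → ∀ k {u v} → Chain G k u v → Chain H k u v
  Chain-mono h zero    eq          = eq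
  Chain-mono h (suc k) (w , e , c) = w , Adj-mono h tt e , Chain-mono h k c

  Within-refl : ∀ {G r u} → Within G r u u
  Within-refl = 0 , z≤n , refl

  Within-Adj : ∀ {G r u v} → Adj G u v → Within G (suc r) u v
  Within-Adj e = 1 , s≤s z≤n , _ , e , refl

  Within-trans : ∀ {G r s u v w} → Within G r u v → Within G s v w → Within G (r + s) u w
  Within-trans (k , k≤r , c) (l , l≤s , c′) = k + l , +-mono-≤ k≤r l≤s , Chain-++ k l c c′

  Within-sym : ∀ {G r u v} → Within G r u v → Within G r v u
  Within-sym (k , k≤r , c) = k , k≤r , Chain-sym k c

  -- Neighbourhoods and induced subgraphs.

  neighbours-mono : ∀ {G H} r {A B} → G ⊑ H → A ⊆ B → neighbours G r A ⊆ neighbours H r B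
  neighbours-mono r h A⊆B (m , u , n , k , k≤r , c) =
    verts-⊑ h tt m , u , A⊆B n , k , k≤r , Chain-mono h k c

  -- Inclusion on `A` suffices: the states kept are those of `A`, the edges kept touch `A`, and the
  -- outer vertices are reached along such edges.
  induced-mono : ∀ {G H A B} → A ⊆ B → G ⊑[ A ] H → induced G A ⊑ induced H B
  induced-mono {G} {H} {A} {B} A⊆B h = record
    { verts-⊑ = λ _ → W
    ; σ-⊑     = λ _ (s , m) → σ-⊑ h (proj₂ m) s , A′ m
    ; δ-⊑     = λ _ → λ { (d , inj₁ (m , n)) → δ-⊑ h (inj₂ (proj₂ n)) d , inj₁ (W m , A′ n)
                        ; (d , inj₂ (m , n)) → δ-⊑ h (inj₁ (proj₂ m)) d , inj₂ (A′ m , W n) }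
    }
    where
    A′ : verts G ∩ A ⊆ verts H ∩ B
    A′ (m , n) = verts-⊑ h n m , A⊆B n
    W : neighbours G 1 (verts G ∩ A) ⊆ neighbours H 1 (verts H ∩ B)
    W (_ , u , m , zero , _ , refl) = proj₁ (A′ m) , u , A′ m , Within-refl
    W (_ , u , m , suc zero , _ , w , e , refl) =
      proj₂ (Adj-verts H e′) , u , A′ m , Within-Adj e′
      where e′ = Adj-mono h (proj₂ m) e
    W (_ , u , m , suc (suc k) , s≤s () , _)

  induced-⊑ : ∀ G A → induced G A ⊑ G
  induced-⊑ G A = record
    { verts-⊑ = λ _ → proj₁
    ; σ-⊑     = λ _ → proj₁
    ; δ-⊑     = λ _ → proj₁
    }

  -- No edge at a vertex of `B` is lost, since its other end is a neighbour of radius one.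
  ⊑-induced : ∀ {G} {A B : Pred V ℓ} → A ⊆ B → G ⊑[ A ] induced G B
  ⊑-induced {G} {A} {B} A⊆B = record
    { verts-⊑ = λ n m → m , _ , (m , A⊆B n) , Within-refl
    ; σ-⊑     = λ n s → s , σ-dom G s , A⊆B n
    ; δ-⊑     = λ { (inj₁ n) d → let (m , m′) = δ-dom G d in
                      d , inj₂ ((m , A⊆B n) , m′ , _ , (m , A⊆B n) , Within-Adj (_ , _ , inj₁ (_ , d)))
                  ; (inj₂ n) d → let (m , m′) = δ-dom G d in
                      d , inj₁ ((m , _ , (m′ , A⊆B n) , Within-Adj (_ , _ , inj₂ (_ , d))) , m′ , A⊆B n) }
    }

  -- Reduces an induced subgraph to the stars of single vertices, the form in which causality
  -- compares images.
  induced-pointwise : ∀ {G H A} →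
    (∀ {v} → v ∈ A → induced G ｛ v ｝ ≈ induced H ｛ v ｝) → induced G A ≈ induced H A
  induced-pointwise {G} {H} {A} h =
    ⊑-antisym (induced-mono (λ m → m) (⊑-pointwise λ m → star (h m)))
              (induced-mono (λ m → m) (⊑-pointwise λ m → star (≈-sym (h m))))
    where
    star : ∀ {K L v} → induced K ｛ v ｝ ≈ induced L ｛ v ｝ → K ⊑[ ｛ v ｝ ] L
    star {K} {L} {v} e =
      ⊑-trans (⊑-induced {B = ｛ v ｝} (λ m → m)) (⊑-weaken (⊑-trans (≈⇒⊑ e) (induced-⊑ L ｛ v ｝)))

  -- Disks, and disks inside larger disks.

  disk-verts : ∀ {G r u v} (u∈G : u ∈ verts G) →
    v ∈ verts (graph (disk G r u u∈G)) → Within G (r + 1) u v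
  -- Here `c` leads to a vertex within `r` of the centre, and `d` is the possible last step into the
  -- outer layer.
  disk-verts u∈G (_ , w , (_ , _ , _ , refl , c) , d) = Within-trans c d

  disk-mono : ∀ {G H} r {u} (u∈G : u ∈ verts G) (u∈H : u ∈ verts H) →
    G ⊑ H → graph (disk G r u u∈G) ⊑ graph (disk H r u u∈H)
  disk-mono r _ _ h = induced-mono (neighbours-mono r h (λ m → m)) (⊑-weaken h)

  disk-cong : ∀ {G H} r {u} (u∈G : u ∈ verts G) (u∈H : u ∈ verts H) →
    G ≈ H → disk G r u u∈G ≈ᴾ disk H r u u∈H
  disk-cong r u∈G u∈H e = record
    { graph-≈   = ⊑-antisym (disk-mono r u∈G u∈H (≈⇒⊑ e)) (disk-mono r u∈H u∈G (≈⇒⊑ (≈-sym e)))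
    ; pointer-≐ = (λ m → m) , (λ m → m)
    }

  module _ {G : Graph} {R : ℕ} {v : V} (v∈G : v ∈ verts G) where

    private
      N : Pred V ℓ
      N = neighbours G R ｛ v ｝

      X : Graph
      X = graph (disk G R v v∈G)

    ball-∈ : ∀ {s u} → u ∈ verts G → Within G s v u → s ≤ R → u ∈ N
    ball-∈ m (k , k≤s , c) s≤R = m , v , refl , k , ≤-trans k≤s s≤R , c

    N⊆X : ∀ {u} → u ∈ N → u ∈ verts X
    N⊆X n = verts-⊑ (⊑-induced {G} {N} {N} (λ m → m)) n (proj₁ n)

    -- Each step starts within `R` of `v`, so its edge touches `N` and survives in `X`. Along the
    -- chain `k` decreases as `s` increases, keeping `k + s` fixed.
    Chain-disk : ∀ k {s u w} → Within G s v u → k + s ≤ R → Chain G k u w → Chain X k u w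
    Chain-disk zero    c le eq          = eq
    Chain-disk (suc k) {s} c le (x , e , d) =
        x , Adj-mono (⊑-induced {G} {N} {N} (λ m → m))
              (ball-∈ (proj₁ (Adj-verts G e)) c (≤-trans (m≤n+m s (suc k)) le)) e
      , Chain-disk k (Within-trans c (Within-Adj {r = 0} e))
          (≤-trans (≤-reflexive (trans (cong (k +_) (+-comm s 1)) (+-suc k s))) le) d

    -- All vertices within `r` of `u` lie in `N`, where `X` has the same states and edges as `G`,
    -- and the chains leading to them stay in `X`.
    disk-disk : ∀ {r s u} (u∈X : u ∈ verts X) (u∈G : u ∈ verts G) →
      Within G s v u → r + s ≤ R → disk X r u u∈X ≈ᴾ disk G r u u∈G
    disk-disk {r} {s} {u} u∈X u∈G c le = record
      { graph-≈   = ⊑-antisym (disk-mono r u∈X u∈G (induced-⊑ G N))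
                              (induced-mono inner (⊑-induced inN))
      ; pointer-≐ = (λ m → m) , (λ m → m)
      }
      where
      inN : neighbours G r ｛ u ｝ ⊆ N
      inN (m , _ , refl , d) =
        ball-∈ m (Within-trans c d) (≤-trans (≤-reflexive (+-comm s r)) le)
      inner : neighbours G r ｛ u ｝ ⊆ neighbours X r ｛ u ｝
      inner n@(m , _ , refl , k , k≤r , d) =
        N⊆X (inN n) , u , refl , k , k≤r , Chain-disk k c (≤-trans (+-mono-≤ k≤r ≤-refl) le) d

    center-∈ : v ∈ verts X
    center-∈ = N⊆X (ball-∈ v∈G Within-refl (z≤n {R}))

  disk-idem : ∀ {G} r {v} (v∈G : v ∈ verts G) →
    disk (graph (disk G r v v∈G)) r v (center-∈ v∈G) ≈ᴾ disk G r v v∈G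
  disk-idem r v∈G =
    disk-disk v∈G (center-∈ v∈G) v∈G (Within-refl {r = 0}) (≤-reflexive (+-comm r 0))

  ⋃-⊑ : ∀ {i} {I : Set i} {G : I → Graph} {K} → IsUnion G K → ∀ i → G i ⊑ K
  ⋃-⊑ un i = record
    { verts-⊑ = λ _ m → proj₂ verts-⋃ (i , m)
    ; σ-⊑     = λ _ s → proj₂ (σ-⋃ _) (i , s)
    ; δ-⊑     = λ _ d → proj₂ (δ-⋃ _ _) (i , d)
    } where open IsUnion un

module Proof {ℓ : Level} (em : ExcludedMiddle (lsuc ℓ)) (V S Δ : Set ℓ) (π : ℕ) where
  open GraphDynamics V S Δ π
  open Locality V S Δ π
  open _⊑[_]_

  emˡ : ExcludedMiddle ℓ
  emˡ {P} = map′ lower lift (em {Lift (lsuc ℓ) P})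

  open Bounds emˡ

  -- Size of balls.

  Within-bound : ∀ G r u → ∣ Within G r u ∣≤ (suc π ^ r)
  Within-bound G zero u = ∣∣≤-coded {n = 1} (λ _ v → u ≡ v) (λ e e′ → trans (sym e) e′)
    λ { (_ , z≤n , e) → zero , e }
  Within-bound G (suc r) u =
    ∣∣≤-mono split (∣∣≤-⋃ {P = Step} (∣∣≤-coded C unique (λ m → m)) (Within-bound G r))
    where
    -- A vertex is left through one of its π ports, or not at all.
    C : Fin (suc π) → Pred V ℓ
    C zero    v = u ≡ v
    C (suc i) v = ∃[ j ] (∃ (δ G (u , i) (v , j)) ⊎ ∃ (δ G (v , j) (u , i)))
    Step : Pred V ℓ
    Step v = ∃[ c ] v ∈ C c
    -- A port carries at most one edge, as source or as target but not both, so it leads to at most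
    -- one vertex.
    unique : ∀ {c v w} → v ∈ C c → w ∈ C c → v ≡ w
    unique {zero}  e e′ = trans (sym e) e′
    unique {suc i} (_ , inj₁ (_ , d)) (_ , inj₁ (_ , e)) = cong proj₁ (δ-source G d e)
    unique {suc i} (_ , inj₁ (_ , d)) (_ , inj₂ (_ , e)) = ⊥-elim (δ-mixed G d e)
    unique {suc i} (_ , inj₂ (_ , d)) (_ , inj₁ (_ , e)) = ⊥-elim (δ-mixed G e d)
    unique {suc i} (_ , inj₂ (_ , d)) (_ , inj₂ (_ , e)) = cong proj₁ (δ-target G d e)
    split : ∀ {v} → Within G (suc r) u v → ∃[ w ] (w ∈ Step × Within G r w v)
    -- An empty chain is padded with a step that stays at `u`, which is what the code `zero` is for.
    split (zero  , _       , refl)            = u , (zero , refl) , Within-refl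
    split (suc k , s≤s k≤r , w , (i , e) , c) = w , (suc i , e) , k , k≤r , c

  -- Antecedents quantify over graphs and so live one universe above vertex
  -- sets; excluded middle brings them down.
  Resize : Set (lsuc ℓ) → Set ℓ
  Resize P = Lift ℓ (True (em {P}))

  resize : ∀ {P} → P → Resize P
  resize x = lift (fromWitness x)

  unresize : ∀ {P} → Resize P → P
  unresize (lift x) = toWitness x

  -- Antecedents and their transport along isomorphisms.

  module _ (F : 𝒢 ⟶ₛ 𝒢) (dyn : IsDynamics graphs F) where
    open IsDynamics dyn

    -- Otherwise the graphs whose image contains `v′` have no common vertex, and by freshness
    -- neither do their images, although all of these contain `v′`.
    antecedent-exists : ∀ v′ → ∃ (antecedents F v′)
    antecedent-exists v′ = decidable-stable em λ none →
      freshness (Σ[ G ∈ Graph ] v′ ∈ verts (F ⟨$⟩ G)) proj₁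
        (λ v m → none (v , λ G n → m (G , n))) v′ proj₂

    antecedents-conj⁻ : ∀ R R′ → (∀ G → F ⟨$⟩ (R · G) ≈ R′ · (F ⟨$⟩ G)) → ∀ {v′ v} →
      v ∈ antecedents F v′ → Inverse.from R v ∈ antecedents F (Inverse.from R′ v′)
    antecedents-conj⁻ R R′ conj α G n = α (R · G) (proj₂ (verts-≐ (conj G)) n)

    -- Writing `G` as `R · R⁻¹ · G` lets the same pair of conjugates serve, so nothing about a
    -- conjugate of `R⁻¹` has to be known.
    antecedents-conj : ∀ R R′ → (∀ G → F ⟨$⟩ (R · G) ≈ R′ · (F ⟨$⟩ G)) → ∀ {v′ v} →
      v ∈ antecedents F (Inverse.from R′ v′) → Inverse.to R v ∈ antecedents F v′
    antecedents-conj R R′ conj α G n =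
      α (R⁻¹ · G) (proj₁ (verts-≐ (≈-trans (Func.cong F G≈) (conj (R⁻¹ · G)))) n)
      where
      open Inverse R using (strictlyInverseˡ)
      R⁻¹ = ↔-sym R
      G≈ : G ≈ R · R⁻¹ · G
      G≈ = record
        { verts-≐ = (λ {v} → subst (verts G) (sym (strictlyInverseˡ v)))
                  , (λ {v} → subst (verts G) (strictlyInverseˡ v))
        ; σ-≐     = λ v → (λ {s} → subst (λ w → σ G w s) (sym (strictlyInverseˡ v)))
                        , (λ {s} → subst (λ w → σ G w s) (strictlyInverseˡ v))
        ; δ-≐     = λ x y →
            (λ {d} e → subst (λ z → δ G z _ d) (sym (port x)) (subst (λ z → δ G _ z d) (sym (port y)) e))
          , (λ {d} e → subst (λ z → δ G z _ d) (port x) (subst (λ z → δ G _ z d) (port y) e))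
        }
        where
        port : ∀ (x : Port) → map₁ (Inverse.to R) (map₁ (Inverse.from R) x) ≡ x
        port (v , i) = cong (_, i) (strictlyInverseˡ v)

    Influenced : Pred V ℓ → Pred V ℓ
    Influenced A v′ = Resize (∃[ v ] (v ∈ A × v ∈ antecedents F v′))

    Influenced-mono : ∀ {A B} → A ⊆ B → Influenced A ⊆ Influenced B
    Influenced-mono A⊆B n = let (v , m , α) = unresize n in resize (v , A⊆B m , α)

    -- From causality to a local rule.

    causal⇒localizable : Causal F → Localizable F
    causal⇒localizable (r , b , local , bound) = r , f , isLocalRule , union
      where
      -- Applying F to the disk itself, rather than to a graph it was cut from,
      -- avoids a choice and makes the freshness of the rule that of F.
      rule : PointedGraph → Graph
      rule X = induced (F ⟨$⟩ graph X) (Influenced (pointer X))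

      rule-mono : ∀ {X Y} → X ≈ᴾ Y → rule X ⊑ rule Y
      rule-mono e = induced-mono (Influenced-mono (proj₁ (pointer-≐ e)))
                                 (⊑-weaken (≈⇒⊑ (Func.cong F (graph-≈ e))))

      f : 𝒟 r ⟶ₛ 𝒢
      f = record
        { to   = λ (X , _) → rule X
        ; cong = λ e → ⊑-antisym (rule-mono e) (rule-mono (≈ᴾ-sym e))
        }

      -- By `disk-idem`, `X` and `G` have the same disk at `v`, so causality equates the stars of
      -- all `v′` with antecedent `v`.
      f-disk : ∀ G v (v∈G : v ∈ verts G) →
        f ⟨$⟩ diskOf r G v v∈G ≈ induced (F ⟨$⟩ G) (Influenced ｛ v ｝)
      f-disk G v v∈G = induced-pointwise λ {v′} n → star v′ (unresize n)
        where
        X = graph (disk G r v v∈G)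
        star : ∀ v′ → ∃[ w ] (v ≡ w × w ∈ antecedents F v′) →
          induced (F ⟨$⟩ X) ｛ v′ ｝ ≈ induced (F ⟨$⟩ G) ｛ v′ ｝
        star v′ (_ , refl , α) = local v′ v α X G (center-∈ v∈G) v∈G (disk-idem r v∈G)

      f-⊑ : ∀ G v (v∈G : v ∈ verts G) → f ⟨$⟩ diskOf r G v v∈G ⊑ F ⟨$⟩ G
      f-⊑ G v v∈G = ⊑-trans (≈⇒⊑ (f-disk G v v∈G)) (induced-⊑ (F ⟨$⟩ G) (Influenced ｛ v ｝))

      -- Causality allows at most `b` influenced vertices; the factor `suc π ^ 1` accounts for the
      -- outer layer of the induced subgraph.
      bounded : ∀ D → ∣ verts (f ⟨$⟩ D) ∣≤ (b * suc π ^ 1)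
      bounded (X , G , v , v∈G , e) = ∣∣≤-mono proj₂
        (∣∣≤-⋃ {P = verts (F ⟨$⟩ graph X) ∩ Influenced (pointer X)}
          (∣∣≤-mono centre (bound (graph X) v (pointer-⊆ X (proj₂ (pointer-≐ e) refl))))
          (Within-bound (F ⟨$⟩ graph X) 1))
        where
        centre : verts (F ⟨$⟩ graph X) ∩ Influenced (pointer X) ⊆
                 (λ v′ → v′ ∈ verts (F ⟨$⟩ graph X) × v ∈ antecedents F v′)
        centre {v′} (m , n) =
          let (w , h , α) = unresize n
          in m , subst (λ z → z ∈ antecedents F v′) (sym (proj₁ (pointer-≐ e) h)) α

      -- A conjugate of `R` through `F` works for the rule too, because `R` and `R′` together
      -- preserve the antecedent relation.
      f-conjugacy : ∀ R → ∃[ R′ ] (∀ D → f ⟨$⟩ (R ·ᴰ D) ≈ R′ · (f ⟨$⟩ D))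
      f-conjugacy R = R′ , λ (X , _) →
        ≈-trans
          (⊑-antisym (induced-mono (fwd X) (⊑-weaken (≈⇒⊑ (conj (graph X)))))
                     (induced-mono (bwd X) (⊑-weaken (≈⇒⊑ (≈-sym (conj (graph X)))))))
          (induced-image R′ (F ⟨$⟩ graph X) (Influenced (pointer X)))
        where
        open Inverse R using (to; from; strictlyInverseʳ)
        R′ = proj₁ (conjugacy R)
        conj = proj₂ (conjugacy R)
        fwd : ∀ X → Influenced (image R (pointer X)) ⊆ image R′ (Influenced (pointer X))
        fwd X n = let (v , m , α) = unresize n in
          resize (from v , m , antecedents-conj⁻ R R′ conj α)
        bwd : ∀ X → image R′ (Influenced (pointer X)) ⊆ Influenced (image R (pointer X))
        bwd X n = let (v , m , α) = unresize n in
          resize (to v , subst (pointer X) (sym (strictlyInverseʳ v)) m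
                 , antecedents-conj R R′ conj α)

      isLocalRule : IsLocalRule r f
      isLocalRule = record
        { consistent = λ G u v u∈G v∈G → ⊑⇒Consistent (f-⊑ G u u∈G) (f-⊑ G v v∈G)
        ; bounded    = b * suc π ^ 1 , bounded
        ; isDynamics = record
          { conjugacy = f-conjugacy
          ; freshness = λ I D none v′ m →
              freshness I (λ i → graph (proj₁ (D i))) none v′ (λ i → proj₁ (m i))
          }
        }

      union : ∀ G → IsUnion (λ ((v , v∈G) : ∃ (verts G)) → f ⟨$⟩ diskOf r G v v∈G) (F ⟨$⟩ G)
      union G = record
        { verts-⋃ = (λ m → at m , verts-⊑ (star m) refl m)
                  , (λ ((v , v∈G) , m) → verts-⊑ (f-⊑ G v v∈G) tt m)
        ; σ-⋃     = λ v′ →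
            (λ s → let m = σ-dom (F ⟨$⟩ G) s in at m , σ-⊑ (star m) refl s)
          , (λ ((v , v∈G) , s) → σ-⊑ (f-⊑ G v v∈G) tt s)
        ; δ-⋃     = λ x y →
            -- An edge is found in the star of its source.
            (λ d → let m = proj₁ (δ-dom (F ⟨$⟩ G) d) in at m , δ-⊑ (star m) (inj₁ refl) d)
          , (λ ((v , v∈G) , d) → δ-⊑ (f-⊑ G v v∈G) (inj₁ tt) d)
        }
        where
        at : ∀ {v′} → v′ ∈ verts (F ⟨$⟩ G) → ∃ (verts G)
        at {v′} m = let (v , α) = antecedent-exists v′ in v , α G m
        star : ∀ {v′} (m : v′ ∈ verts (F ⟨$⟩ G)) →
          F ⟨$⟩ G ⊑[ ｛ v′ ｝ ] f ⟨$⟩ diskOf r G (proj₁ (at m)) (proj₂ (at m))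
        star {v′} m = let (v , α) = antecedent-exists v′ in
          ⊑-trans (⊑-induced λ { refl → resize (v , refl , α) })
                  (⊑-weaken (≈⇒⊑ (≈-sym (f-disk G v (α G m)))))

    -- From a local rule to causality.

    localizable⇒causal : Localizable F → Causal F
    localizable⇒causal (r , f , isLocalRule , union) =
      R , suc π ^ (r + 1) * b , local , bound
      where
      open IsLocalRule isLocalRule using (bounded)
      b = proj₁ bounded

      -- A relevant disk has its centre within `r + 1` of `v` and its own radius is `r`.
      R : ℕ
      R = r + (r + 1)

      f-⊑ : ∀ G u (u∈G : u ∈ verts G) → f ⟨$⟩ diskOf r G u u∈G ⊑ F ⟨$⟩ G
      f-⊑ G u u∈G = ⋃-⊑ (union G) (u , u∈G)

      -- The disk at u, seen as a graph, has itself as disk at u; so its image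
      -- under F already contains v′, and the disk must contain v.
      source-near : ∀ {v v′ G u} (u∈G : u ∈ verts G) → v ∈ antecedents F v′ →
        v′ ∈ verts (f ⟨$⟩ diskOf r G u u∈G) → Within G (r + 1) v u
      source-near {G = G} {u} u∈G α m = Within-sym (disk-verts u∈G
        (α X (verts-⊑ (⊑-trans (≈⇒⊑ (Func.cong f {diskOf r G u u∈G} {diskOf r X u u∈X}
                                      (≈ᴾ-sym (disk-idem r u∈G))))
                               (f-⊑ X u u∈X)) tt m)))
        where
        X = graph (disk G r u u∈G)
        u∈X = center-∈ u∈G

      -- The disk at `u` can be read off the disk at `v`, so `H` has the same disk at `u` and the
      -- rule contributes the same piece to the image of `H`.
      f-local : ∀ {v v′ G H} (v∈G : v ∈ verts G) (v∈H : v ∈ verts H) →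
        disk G R v v∈G ≈ᴾ disk H R v v∈H → v ∈ antecedents F v′ →
        ∀ {u} (u∈G : u ∈ verts G) → v′ ∈ verts (f ⟨$⟩ diskOf r G u u∈G) →
        f ⟨$⟩ diskOf r G u u∈G ⊑ F ⟨$⟩ H
      f-local {v} {G = G} {H} v∈G v∈H e α {u} u∈G m =
        ⊑-trans (≈⇒⊑ (Func.cong f {diskOf r G u u∈G} {diskOf r H u u∈H} same)) (f-⊑ H u u∈H)
        where
        c : Within G (r + 1) v u
        c = source-near u∈G α m
        u∈N : u ∈ neighbours G R ｛ v ｝
        u∈N = ball-∈ v∈G u∈G c (m≤n+m (r + 1) r)
        u∈X : u ∈ verts (graph (disk G R v v∈G))
        u∈X = N⊆X v∈G u∈N
        u∈Y : u ∈ verts (graph (disk H R v v∈H))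
        u∈Y = proj₁ (verts-≐ (graph-≈ e)) u∈X
        u∈H : u ∈ verts H
        u∈H = proj₁ u∈Y
        -- The distance bound must hold in `H` as well: the chain from `v` to `u` runs inside the
        -- disk at `v`, and `e` carries it over.
        cᴴ : Within H (r + 1) v u
        cᴴ = let (k , k≤ , d) = c in
          k , k≤ , Chain-mono (⊑-trans (≈⇒⊑ (graph-≈ e)) (induced-⊑ H _)) k
            (Chain-disk v∈G k (Within-refl {r = 0})
              (≤-trans (≤-reflexive (+-comm k 0)) (≤-trans k≤ (m≤n+m (r + 1) r))) d)
        same : disk G r u u∈G ≈ᴾ disk H r u u∈H
        same = ≈ᴾ-trans (≈ᴾ-sym (disk-disk v∈G u∈X u∈G c ≤-refl))
              (≈ᴾ-trans (disk-cong r u∈X u∈Y (graph-≈ e))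
                        (disk-disk v∈H u∈Y u∈H cᴴ ≤-refl))

      -- The vertex `v′`, its state and each of its edges come from some `f ⟨$⟩ diskOf r G u u∈G`
      -- that contains `v′`, and `f-local` moves that whole piece.
      ⊑-local : ∀ {v v′ G H} (v∈G : v ∈ verts G) (v∈H : v ∈ verts H) →
        disk G R v v∈G ≈ᴾ disk H R v v∈H → v ∈ antecedents F v′ →
        F ⟨$⟩ G ⊑[ ｛ v′ ｝ ] F ⟨$⟩ H
      ⊑-local {G = G} v∈G v∈H e α = record
        { verts-⊑ = λ { refl m → let ((u , u∈G) , n) = proj₁ verts-⋃ m in
            verts-⊑ (f-local v∈G v∈H e α u∈G n) tt n }
        ; σ-⊑     = λ { refl s → let ((u , u∈G) , n) = proj₁ (σ-⋃ _) s in
            σ-⊑ (f-local v∈G v∈H e α u∈G (σ-dom (f ⟨$⟩ diskOf r G u u∈G) n)) tt n }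
        ; δ-⊑     = λ
            { (inj₁ refl) d → let ((u , u∈G) , n) = proj₁ (δ-⋃ _ _) d in
                δ-⊑ (f-local v∈G v∈H e α u∈G (proj₁ (δ-dom (f ⟨$⟩ diskOf r G u u∈G) n))) (inj₁ tt) n
            ; (inj₂ refl) d → let ((u , u∈G) , n) = proj₁ (δ-⋃ _ _) d in
                δ-⊑ (f-local v∈G v∈H e α u∈G (proj₂ (δ-dom (f ⟨$⟩ diskOf r G u u∈G) n))) (inj₁ tt) n }
        }
        where open IsUnion (union G)

      local : ∀ v′ v → v ∈ antecedents F v′ →
        ∀ G H (v∈G : v ∈ verts G) (v∈H : v ∈ verts H) →
        disk G R v v∈G ≈ᴾ disk H R v v∈H →
        induced (F ⟨$⟩ G) ｛ v′ ｝ ≈ induced (F ⟨$⟩ H) ｛ v′ ｝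
      local v′ v α G H v∈G v∈H e =
        ⊑-antisym (induced-mono (λ m → m) (⊑-local v∈G v∈H e α))
                  (induced-mono (λ m → m) (⊑-local v∈H v∈G (≈ᴾ-sym e) α))

      bound : ∀ G v → v ∈ verts G →
        ∣ (λ v′ → v′ ∈ verts (F ⟨$⟩ G) × v ∈ antecedents F v′) ∣≤ (suc π ^ (r + 1) * b)
      bound G v v∈G = ∣∣≤-mono cover (∣∣≤-⋃ (Within-bound G (r + 1) v) bound-f)
        where
        Q : V → Pred V ℓ
        Q u v′ = Σ[ u∈G ∈ verts G u ] v′ ∈ verts (f ⟨$⟩ diskOf r G u u∈G)
        -- `Q u` is empty for `u` outside `G`. Inside, all membership proofs give equal disks, so
        -- one image of the rule covers `Q u`.
        bound-f : ∀ u → ∣ Q u ∣≤ b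
        bound-f u with emˡ {u ∈ verts G}
        ... | yes u∈G = ∣∣≤-mono
              (λ (u∈G′ , n) → proj₁ (verts-≐ (Func.cong f {diskOf r G u u∈G′} {diskOf r G u u∈G}
                (disk-cong r u∈G′ u∈G ≈-refl))) n)
              (proj₂ bounded (diskOf r G u u∈G))
        ... | no u∉G = record
              { to        = λ (_ , u∈G , _) → ⊥-elim (u∉G u∈G)
              ; cong      = λ { {_ , u∈G , _} → ⊥-elim (u∉G u∈G) }
              ; injective = λ { {_ , u∈G , _} → ⊥-elim (u∉G u∈G) }
              }
        cover : (λ v′ → v′ ∈ verts (F ⟨$⟩ G) × v ∈ antecedents F v′) ⊆
                (λ v′ → ∃[ u ] (Within G (r + 1) v u × v′ ∈ Q u))
        cover (m , α) = let ((u , u∈G) , n) = proj₁ (IsUnion.verts-⋃ (union G)) m in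
          u , source-near u∈G α n , u∈G , n

theorem1 : ∀ {ℓ : Level} → ExcludedMiddle (lsuc ℓ) →
    (V S Δ : Set ℓ) (π : ℕ) → Uncountable V →
    let open GraphDynamics V S Δ π in
    (F : 𝒢 ⟶ₛ 𝒢) → IsDynamics graphs F → Causal F ⇔ Localizable F
theorem1 em V S Δ π _ F dyn = mk⇔ (causal⇒localizable F dyn) (localizable⇒causal F dyn)
  where open Proof em V S Δ π
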